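{- Let $\mathbf{L}$ be the Lindenbaum algebra for $\mathbf{LI}$ and let $\mathbf{L}\subseteq\mathbf{G}$ be a regular completion. Let $\mathcal{M}(\mathbf{G})$ be the full Heyting-valued structure over $\mathbf{G}$ and $\mathcal{I}$ the valuation on it defined by $\mathcal{I}(X)(t):=[X(t)]$ (both described in the context). For every sentence $\forall X.\varphi$ in $\mathsf{FMP}_0$, the following are equivalent: 1. $\mathcal{I}(\forall X.\varphi)=\bigvee\{a\in\mathbf{L} : a\le\mathcal{I}(\forall X.\varphi)\}$. 2. $\mathcal{I}(\forall X.\varphi)=\bigvee\{[\Delta]\in\mathbf{L} : \Delta\in|\forall X.\varphi|_0\}$. 3. For every $y\in\mathbf{G}$: if $\mathcal{I}(\Delta)\le y$ for all $\Delta\in|\forall X.\varphi|_0$, then $\mathcal{I}(\forall X.\varphi)\le y$. If $\mathbf{G}$ is the MacNeille completion of $\mathbf{L}$, then conditions 1, 2 and 3 all hold for every sentence $\forall X.\varphi$ in $\mathsf{FMP}_0$.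
   Context: **Syntax.** Fix a language of first order function and predicate symbols, countably many term variables and countably many (unary) set variables $X,Y,\dots$; $\mathsf{Tm}$ is the set of terms (including open ones). $\mathsf{Fm}$ is the set of formulas $\varphi,\psi ::= p(\vec t)\mid X(t)\mid\bot\mid\varphi\star\psi\mid Qx.\varphi$ ($\star\in\{\wedge,\vee,\rightarrow\}$, $Q\in\{\forall,\exists\}$), i.e. without second order quantifiers. $\mathsf{FMP}_0$ is given by the same grammar plus $QX.\xi$ with $\xi\in\mathsf{Fm}$ whose free set variables are among $\{X\}$. $\mathsf{FV}$ denotes free set variables. $\mathbf{LI}$ is the ordinary (single-conclusion, Gentzen-style) sequent calculus for first order intuitionistic logic on $\mathsf{Fm}$ (set variables behave as unary predicate symbols), with sequents $\Gamma\Rightarrow\Pi$, $\Gamma$ a finite set of formulas and $\Pi$ empty or a singleton; $\vdash^{cf}$ denotes cut-free derivability. For $\forall X.\varphi(X)\in\mathsf{FMP}_0$, $|\forall X.\varphi|_0$ is the set of finite sets $\Delta\subseteq\mathsf{Fm}$ such that $\mathbf{LI}\vdash^{cf}\Delta\Rightarrow\varphi(Y)$ for some $Y\notin\mathsf{FV}(\Delta)$. **Lindenbaum algebra.** $\mathbf{L}=\mathsf{Fm}/{\sim}$ with $\varphi\sim\psi$ iff $\mathbf{LI}\vdash\varphi\leftrightarrow\psi$, a Heyting algebra; $[\varphi]$ is the class of $\varphi$, and for finite $\Delta$, $[\Delta]$ is the class of the conjunction of $\Delta$ ($\top$ if empty). **Completions.** A completion $\mathbf{L}\subseteq\mathbf{G}$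 is a complete Heyting algebra $\mathbf{G}$ having $\mathbf{L}$ as a Heyting subalgebra. It is regular if it preserves all joins and meets that exist in $\mathbf{L}$. It is MacNeille if every $x\in\mathbf{G}$ satisfies $x=\bigvee\{a\in\mathbf{L}:a\le x\}$ and $x=\bigwedge\{a\in\mathbf{L}:x\le a\}$. **Structure and interpretation.** $\mathcal{M}(\mathbf{G})$ has term domain $\mathsf{Tm}$ (function symbols interpreted as term constructors), truth value algebra $\mathbf{G}$, set variables ranging over all of $\mathbf{G}^{\mathsf{Tm}}$, and predicate symbols interpreted by $p(\vec t)\mapsto[p(\vec t)]$. A valuation $\mathcal{V}$ assigns to each set variable an element of $\mathbf{G}^{\mathsf{Tm}}$ and extends to formulas by $\mathcal{V}(p(\vec t))=[p(\vec t)]$, $\mathcal{V}(X(t))=\mathcal{V}(X)(t)$, $\mathcal{V}(\bot)=\bot$, $\mathcal{V}(\varphi\star\psi)=\mathcal{V}(\varphi)\star\mathcal{V}(\psi)$, $\mathcal{V}(\forall x.\varphi(x))=\bigwedge_{t\in\mathsf{Tm}}\mathcal{V}(\varphi(t))$, $\mathcal{V}(\exists x.\varphi(x))=\bigvee_{t\in\mathsf{Tm}}\mathcal{V}(\varphi(t))$, $\mathcal{V}(\forall X.\varphi)=\bigwedge_{F\in\mathbf{G}^{\mathsf{Tm}}}\mathcal{V}[F/X](\varphi)$, $\mathcal{V}(\exists X.\varphi)=\bigvee_{F\in\mathbf{G}^{\mathsf{Tm}}}\mathcal{V}[F/X](\varphi)$, where $\mathcal{V}[F/X]$ is $\mathcal{V}$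 updated to send $X$ to $F$. For a finite set $\Delta$, $\mathcal{V}(\Delta)=\bigwedge_{\psi\in\Delta}\mathcal{V}(\psi)$. -}

module Defs where

open import Algebra.Core using (Op₂)
open import Algebra.Morphism.Definitions using (Homomorphic₀; Homomorphic₂)
open import Data.List.Base using (List; []; _∷_; _++_; map; filter; foldr)
open import Data.List.Membership.Propositional using (_∈_; _∉_)
open import Data.List.Relation.Binary.Subset.Propositional using (_⊆_)
open import Data.List.Relation.Unary.Any using (here; there)
open import Data.Maybe.Base as Maybe using (Maybe; just; nothing)
open import Data.Nat.Base using (ℕ; zero; suc)
open import Data.Nat.Properties using (_≟_)
open import Data.Product.Base using (_×_; _,_; proj₁; proj₂; ∃-syntax)
open import Data.Vec.Base using (Vec; []; _∷_)
open import Function.Base using (_∘_)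
open import Function.Definitions using (Congruent; Injective)
open import Level using (Level; _⊔_) renaming (suc to lsuc)
open import Relation.Binary.Core using (Rel)
open import Relation.Binary.Lattice using (HeytingAlgebra)
import Relation.Binary.Lattice.Properties.JoinSemilattice as JoinProperties
import Relation.Binary.Lattice.Properties.MeetSemilattice as MeetProperties
import Relation.Binary.Lattice.Properties.HeytingAlgebra as HeytingProperties
open import Relation.Binary.PropositionalEquality
  using (_≡_; refl; sym; trans; cong; cong₂; subst)
open import Relation.Nullary.Decidable using (yes; no; ¬?)
open import Relation.Unary using (Pred)

module _ {a ℓ} {A : Set a} (_≤_ : Rel A ℓ) where

  IsSup : ∀ {p} → Pred A p → A → Set (a ⊔ ℓ ⊔ p)
  IsSup P s = (∀ x → P x → x ≤ s) × (∀ u → (∀ x → P x → x ≤ u) → s ≤ u)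

  IsInf : ∀ {p} → Pred A p → A → Set (a ⊔ ℓ ⊔ p)
  IsInf P i = (∀ x → P x → i ≤ x) × (∀ l → (∀ x → P x → l ≤ x) → l ≤ i)

-- A single universe level is used for the carrier, for equality and order, and
-- for subsets, so that "all subsets" includes the range of any family indexed
-- by functions into the carrier, as second order quantification requires.
record CompleteHeytingAlgebra (ℓ : Level) : Set (lsuc ℓ) where
  field
    heytingAlgebra : HeytingAlgebra ℓ ℓ ℓ

  open HeytingAlgebra heytingAlgebra public

  field
    ⋁     : Pred Carrier ℓ → Carrier
    ⋀     : Pred Carrier ℓ → Carrier
    ⋁-sup : ∀ P → IsSup _≤_ P (⋁ P)
    ⋀-inf : ∀ P → IsInf _≤_ P (⋀ P)

  -- The subset { f a ∣ P a }.
  image : ∀ {a p} {A : Set a} → (A → Carrier) → Pred A p → Pred Carrier (a ⊔ p ⊔ ℓ)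
  image f P x = ∃[ a ] P a × x ≈ f a

  range : ∀ {i} {I : Set i} → (I → Carrier) → Pred Carrier (i ⊔ ℓ)
  range f x = ∃[ i ] x ≈ f i

record Completion {ℓ} (H : HeytingAlgebra ℓ ℓ ℓ) : Set (lsuc ℓ) where
  private module H = HeytingAlgebra H
  field
    complete : CompleteHeytingAlgebra ℓ

  open CompleteHeytingAlgebra complete public

  field
    ι           : H.Carrier → Carrier
    ι-cong      : Congruent H._≈_ _≈_ ι
    ι-injective : Injective H._≈_ _≈_ ι
    ι-∧         : Homomorphic₂ H.Carrier Carrier _≈_ ι H._∧_ _∧_
    ι-∨         : Homomorphic₂ H.Carrier Carrier _≈_ ι H._∨_ _∨_
    ι-⇨         : Homomorphic₂ H.Carrier Carrier _≈_ ι H._⇨_ _⇨_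
    ι-⊤         : Homomorphic₀ H.Carrier Carrier _≈_ ι H.⊤ ⊤
    ι-⊥         : Homomorphic₀ H.Carrier Carrier _≈_ ι H.⊥ ⊥

  IsRegular : Set (lsuc ℓ)
  IsRegular = ∀ (S : Pred H.Carrier ℓ) (a : H.Carrier) →
    (IsSup H._≤_ S a → IsSup _≤_ (image ι S) (ι a)) ×
    (IsInf H._≤_ S a → IsInf _≤_ (image ι S) (ι a))

  IsMacNeille : Set ℓ
  IsMacNeille = ∀ (x : Carrier) →
    x ≈ ⋁ (image ι (λ a → ι a ≤ x)) ×
    x ≈ ⋀ (image ι (λ a → x ≤ ι a))

record Language (ℓ : Level) : Set (lsuc ℓ) where
  field
    FunSym : Set ℓ
    RelSym : Set ℓ
    arityF : FunSym → ℕ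
    arityR : RelSym → ℕ

data Conn : Set where
  and or imp : Conn

data Quant : Set where
  all ex : Quant

module Logic {ℓ} (𝓛 : Language ℓ) where
  open Language 𝓛

  -- Syntax.  Term variables are de Bruijn indices, so that formulas are
  -- identified up to renaming of bound term variables; set variables are named.

  SVar : Set
  SVar = ℕ

  data Tm : Set ℓ where
    var : ℕ → Tm
    fn  : (f : FunSym) → Vec Tm (arityF f) → Tm

  infix 30 _·_

  data Fm : Set ℓ where
    rel   : (p : RelSym) → Vec Tm (arityR p) → Fm
    _·_   : SVar → Tm → Fm
    bot   : Fm
    bin   : Conn → Fm → Fm → Fm
    quant : Quant → Fm → Fm

  infixr 8 _∧ᶠ_
  infixr 7 _∨ᶠ_
  infixr 6 _→ᶠ_
  infix  5 _↔ᶠ_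

  pattern _∧ᶠ_ φ ψ = bin and φ ψ
  pattern _∨ᶠ_ φ ψ = bin or φ ψ
  pattern _→ᶠ_ φ ψ = bin imp φ ψ
  pattern ∀ᶠ φ     = quant all φ
  pattern ∃ᶠ φ     = quant ex φ

  ⊤ᶠ : Fm
  ⊤ᶠ = bot →ᶠ bot

  _↔ᶠ_ : Fm → Fm → Fm
  φ ↔ᶠ ψ = (φ →ᶠ ψ) ∧ᶠ (ψ →ᶠ φ)

  ⋀ᶠ : List Fm → Fm
  ⋀ᶠ = foldr _∧ᶠ_ ⊤ᶠ

  FV : Fm → List SVar
  FV (rel p ts)  = []
  FV (X · t)     = X ∷ []
  FV bot         = []
  FV (bin _ φ ψ) = FV φ ++ FV ψ
  FV (quant _ φ) = FV φ

  data FMP₀ : Set ℓ where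
    rel    : (p : RelSym) → Vec Tm (arityR p) → FMP₀
    _·_    : SVar → Tm → FMP₀
    bot    : FMP₀
    bin    : Conn → FMP₀ → FMP₀ → FMP₀
    quant  : Quant → FMP₀ → FMP₀
    quant² : Quant → (X : SVar) (ξ : Fm) → FV ξ ⊆ X ∷ [] → FMP₀

  pattern ∀² X ξ ξ⊆X = quant² all X ξ ξ⊆X

  FV₀ : FMP₀ → List SVar
  FV₀ (rel p ts)       = []
  FV₀ (X · t)          = X ∷ []
  FV₀ bot              = []
  FV₀ (bin _ φ ψ)      = FV₀ φ ++ FV₀ ψ
  FV₀ (quant _ φ)      = FV₀ φ
  FV₀ (quant² _ X ξ _) = filter (λ Y → ¬? (Y ≟ X)) (FV ξ)

  unbind : List ℕ → List ℕ
  unbind []           = []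
  unbind (zero  ∷ ns) = unbind ns
  unbind (suc n ∷ ns) = n ∷ unbind ns

  mutual
    fvᵗ : Tm → List ℕ
    fvᵗ (var n)   = n ∷ []
    fvᵗ (fn f ts) = fvᵗˢ ts

    fvᵗˢ : ∀ {n} → Vec Tm n → List ℕ
    fvᵗˢ []       = []
    fvᵗˢ (t ∷ ts) = fvᵗ t ++ fvᵗˢ ts

  fv : Fm → List ℕ
  fv (rel p ts)  = fvᵗˢ ts
  fv (X · t)     = fvᵗ t
  fv bot         = []
  fv (bin _ φ ψ) = fv φ ++ fv ψ
  fv (quant _ φ) = unbind (fv φ)

  fv₀ : FMP₀ → List ℕ
  fv₀ (rel p ts)       = fvᵗˢ ts
  fv₀ (X · t)          = fvᵗ t
  fv₀ bot              = []
  fv₀ (bin _ φ ψ)      = fv₀ φ ++ fv₀ ψ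
  fv₀ (quant _ φ)      = unbind (fv₀ φ)
  fv₀ (quant² _ _ ξ _) = fv ξ

  IsSentence : FMP₀ → Set
  IsSentence φ = FV₀ φ ≡ [] × fv₀ φ ≡ []

  Sub : Set ℓ
  Sub = ℕ → Tm

  infixr 5 _•_
  _•_ : Tm → Sub → Sub
  (t • σ) zero    = t
  (t • σ) (suc n) = σ n

  infixl 20 _[_]ᵗ _[_]ᵗˢ _[_] _[_]₀ _⟨_⟩ _⟨_⟩₀ _⟨_/_⟩ˢ

  mutual
    _[_]ᵗ : Tm → Sub → Tm
    var n   [ σ ]ᵗ = σ n
    fn f ts [ σ ]ᵗ = fn f (ts [ σ ]ᵗˢ)

    _[_]ᵗˢ : ∀ {n} → Vec Tm n → Sub → Vec Tm n
    []       [ σ ]ᵗˢ = []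
    (t ∷ ts) [ σ ]ᵗˢ = t [ σ ]ᵗ ∷ ts [ σ ]ᵗˢ

  lift : Sub → Sub
  lift σ = var 0 • λ n → σ n [ var ∘ suc ]ᵗ

  _[_] : Fm → Sub → Fm
  rel p ts  [ σ ] = rel p (ts [ σ ]ᵗˢ)
  (X · t)   [ σ ] = X · (t [ σ ]ᵗ)
  bot       [ σ ] = bot
  bin c φ ψ [ σ ] = bin c (φ [ σ ]) (ψ [ σ ])
  quant Q φ [ σ ] = quant Q (φ [ lift σ ])

  FV-[] : ∀ φ σ → FV (φ [ σ ]) ≡ FV φ
  FV-[] (rel p ts)  σ = refl
  FV-[] (X · t)     σ = refl
  FV-[] bot         σ = refl
  FV-[] (bin c φ ψ) σ = cong₂ _++_ (FV-[] φ σ) (FV-[] ψ σ)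
  FV-[] (quant Q φ) σ = FV-[] φ (lift σ)

  _[_]₀ : FMP₀ → Sub → FMP₀
  rel p ts         [ σ ]₀ = rel p (ts [ σ ]ᵗˢ)
  (X · t)          [ σ ]₀ = X · (t [ σ ]ᵗ)
  bot              [ σ ]₀ = bot
  bin c φ ψ        [ σ ]₀ = bin c (φ [ σ ]₀) (ψ [ σ ]₀)
  quant Q φ        [ σ ]₀ = quant Q (φ [ lift σ ]₀)
  quant² Q X ξ ξ⊆X [ σ ]₀ =
    quant² Q X (ξ [ σ ]) (subst (_⊆ X ∷ []) (sym (FV-[] ξ σ)) ξ⊆X)

  -- φ ⟨ t ⟩ is φ(t), for φ the body of a quantifier.
  _⟨_⟩ : Fm → Tm → Fm
  φ ⟨ t ⟩ = φ [ t • var ]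

  _⟨_⟩₀ : FMP₀ → Tm → FMP₀
  φ ⟨ t ⟩₀ = φ [ t • var ]₀

  ↑ : Fm → Fm
  ↑ φ = φ [ var ∘ suc ]

  rename : SVar → SVar → SVar → SVar
  rename Y X Z with Z ≟ X
  ... | yes _ = Y
  ... | no  _ = Z

  -- φ ⟨ Y / X ⟩ˢ replaces the set variable X by Y; written φ(Y) when φ = φ(X).
  _⟨_/_⟩ˢ : Fm → SVar → SVar → Fm
  rel p ts  ⟨ Y / X ⟩ˢ = rel p ts
  (Z · t)   ⟨ Y / X ⟩ˢ = rename Y X Z · t
  bot       ⟨ Y / X ⟩ˢ = bot
  bin c φ ψ ⟨ Y / X ⟩ˢ = bin c (φ ⟨ Y / X ⟩ˢ) (ψ ⟨ Y / X ⟩ˢ)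
  quant Q φ ⟨ Y / X ⟩ˢ = quant Q (φ ⟨ Y / X ⟩ˢ)

  mutual
    []ᵗ-∘ : ∀ {σ ρ τ} → (∀ n → σ n [ ρ ]ᵗ ≡ τ n) →
            ∀ t → t [ σ ]ᵗ [ ρ ]ᵗ ≡ t [ τ ]ᵗ
    []ᵗ-∘ e (var n)   = e n
    []ᵗ-∘ e (fn f ts) = cong (fn f) ([]ᵗˢ-∘ e ts)

    []ᵗˢ-∘ : ∀ {σ ρ τ} → (∀ n → σ n [ ρ ]ᵗ ≡ τ n) →
             ∀ {n} (ts : Vec Tm n) → ts [ σ ]ᵗˢ [ ρ ]ᵗˢ ≡ ts [ τ ]ᵗˢ
    []ᵗˢ-∘ e []       = refl
    []ᵗˢ-∘ e (t ∷ ts) = cong₂ _∷_ ([]ᵗ-∘ e t) ([]ᵗˢ-∘ e ts)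

  mutual
    []ᵗ-id : ∀ t → t [ var ]ᵗ ≡ t
    []ᵗ-id (var n)   = refl
    []ᵗ-id (fn f ts) = cong (fn f) ([]ᵗˢ-id ts)

    []ᵗˢ-id : ∀ {n} (ts : Vec Tm n) → ts [ var ]ᵗˢ ≡ ts
    []ᵗˢ-id []       = refl
    []ᵗˢ-id (t ∷ ts) = cong₂ _∷_ ([]ᵗ-id t) ([]ᵗˢ-id ts)

  lift-• : ∀ {σ ρ τ} → (∀ n → σ n [ ρ ]ᵗ ≡ τ n) →
           ∀ t n → lift σ n [ t • ρ ]ᵗ ≡ (t • τ) n
  lift-•     e t zero    = refl
  lift-• {σ} e t (suc n) = trans ([]ᵗ-∘ (λ _ → refl) (σ n)) (e n)

  •-var : ∀ t n → (t • var) n [ var ]ᵗ ≡ (t • var) n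
  •-var t n = []ᵗ-id ((t • var) n)

  data Mode : Set where
    withCut cutFree : Mode

  infix 4 _⊢_⇒_

  -- Antecedents are finite sets, represented by lists whose order and
  -- multiplicities the rule wkL makes immaterial.  The eigenvariable of ∀R and
  -- ∃L is index 0, fresh for the shifted side formulas.
  data _⊢_⇒_ (m : Mode) : List Fm → Maybe Fm → Set ℓ where
    id  : ∀ {Γ φ} → m ⊢ φ ∷ Γ ⇒ just φ
    cut : ∀ {Γ φ Π} → m ≡ withCut →
          m ⊢ Γ ⇒ just φ → m ⊢ φ ∷ Γ ⇒ Π → m ⊢ Γ ⇒ Π
    wkL : ∀ {Γ Δ Π} → Γ ⊆ Δ → m ⊢ Γ ⇒ Π → m ⊢ Δ ⇒ Π
    wkR : ∀ {Γ φ} → m ⊢ Γ ⇒ nothing → m ⊢ Γ ⇒ just φ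
    ⊥L  : ∀ {Γ Π} → m ⊢ bot ∷ Γ ⇒ Π
    ∧L₁ : ∀ {Γ φ ψ Π} → m ⊢ φ ∷ Γ ⇒ Π → m ⊢ φ ∧ᶠ ψ ∷ Γ ⇒ Π
    ∧L₂ : ∀ {Γ φ ψ Π} → m ⊢ ψ ∷ Γ ⇒ Π → m ⊢ φ ∧ᶠ ψ ∷ Γ ⇒ Π
    ∧R  : ∀ {Γ φ ψ} → m ⊢ Γ ⇒ just φ → m ⊢ Γ ⇒ just ψ → m ⊢ Γ ⇒ just (φ ∧ᶠ ψ)
    ∨L  : ∀ {Γ φ ψ Π} → m ⊢ φ ∷ Γ ⇒ Π → m ⊢ ψ ∷ Γ ⇒ Π → m ⊢ φ ∨ᶠ ψ ∷ Γ ⇒ Π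
    ∨R₁ : ∀ {Γ φ ψ} → m ⊢ Γ ⇒ just φ → m ⊢ Γ ⇒ just (φ ∨ᶠ ψ)
    ∨R₂ : ∀ {Γ φ ψ} → m ⊢ Γ ⇒ just ψ → m ⊢ Γ ⇒ just (φ ∨ᶠ ψ)
    →L  : ∀ {Γ φ ψ Π} → m ⊢ Γ ⇒ just φ → m ⊢ ψ ∷ Γ ⇒ Π → m ⊢ φ →ᶠ ψ ∷ Γ ⇒ Π
    →R  : ∀ {Γ φ ψ} → m ⊢ φ ∷ Γ ⇒ just ψ → m ⊢ Γ ⇒ just (φ →ᶠ ψ)
    ∀L  : ∀ {Γ φ Π} t → m ⊢ φ ⟨ t ⟩ ∷ Γ ⇒ Π → m ⊢ ∀ᶠ φ ∷ Γ ⇒ Π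
    ∀R  : ∀ {Γ φ} → m ⊢ map ↑ Γ ⇒ just φ → m ⊢ Γ ⇒ just (∀ᶠ φ)
    ∃L  : ∀ {Γ φ Π} → m ⊢ φ ∷ map ↑ Γ ⇒ Maybe.map ↑ Π → m ⊢ ∃ᶠ φ ∷ Γ ⇒ Π
    ∃R  : ∀ {Γ φ} t → m ⊢ Γ ⇒ just (φ ⟨ t ⟩) → m ⊢ Γ ⇒ just (∃ᶠ φ)

  infix 4 LI⊢_⇒_ LI⊢ᶜᶠ_⇒_

  LI⊢_⇒_ LI⊢ᶜᶠ_⇒_ : List Fm → Maybe Fm → Set ℓ
  LI⊢_⇒_   = withCut ⊢_⇒_
  LI⊢ᶜᶠ_⇒_ = cutFree ⊢_⇒_

  ∣∀²_,_∣₀ : SVar → Fm → Pred (List Fm) ℓ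
  ∣∀² X , φ ∣₀ Δ = ∃[ Y ] (∀ ψ → ψ ∈ Δ → Y ∉ FV ψ) × LI⊢ᶜᶠ Δ ⇒ just (φ ⟨ Y / X ⟩ˢ)

  -- In the Lindenbaum algebra, the class of φ is represented by φ itself.

  infix 4 _∼_ _≲_

  _∼_ _≲_ : Fm → Fm → Set ℓ
  φ ∼ ψ = LI⊢ [] ⇒ just (φ ↔ᶠ ψ)
  φ ≲ ψ = LI⊢ φ ∷ [] ⇒ just ψ

  private
    cut′ : ∀ {Γ φ Π} → LI⊢ Γ ⇒ just φ → LI⊢ φ ∷ [] ⇒ Π → LI⊢ Γ ⇒ Π
    cut′ d e = cut refl d (wkL (λ { (here p) → here p ; (there ()) }) e)

    ≲-trans : ∀ {φ ψ χ} → φ ≲ ψ → ψ ≲ χ → φ ≲ χ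
    ≲-trans = cut′

    mp : ∀ {φ ψ} → LI⊢ [] ⇒ just (φ →ᶠ ψ) → φ ≲ ψ
    mp d = cut refl (wkL (λ ()) d) (→L id id)

    ∼⇒≲ : ∀ {φ ψ} → φ ∼ ψ → φ ≲ ψ
    ∼⇒≲ d = mp (cut′ d (∧L₁ id))

    ∼⇒≳ : ∀ {φ ψ} → φ ∼ ψ → ψ ≲ φ
    ∼⇒≳ d = mp (cut′ d (∧L₂ id))

    ≲-antisym : ∀ {φ ψ} → φ ≲ ψ → ψ ≲ φ → φ ∼ ψ
    ≲-antisym d e = ∧R (→R d) (→R e)

    curryᶠ : ∀ {φ ψ χ} → φ ∧ᶠ ψ ≲ χ → φ ≲ ψ →ᶠ χ
    curryᶠ d = →R (cut′ (∧R (wkL there id) id) d)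

    uncurryᶠ : ∀ {φ ψ χ} → φ ≲ ψ →ᶠ χ → φ ∧ᶠ ψ ≲ χ
    uncurryᶠ d = cut refl (cut′ (∧L₁ id) d) (→L (∧L₂ id) id)

  Lindenbaum : HeytingAlgebra ℓ ℓ ℓ
  Lindenbaum = record
    { Carrier = Fm
    ; _≈_ = _∼_
    ; _≤_ = _≲_
    ; _∨_ = _∨ᶠ_
    ; _∧_ = _∧ᶠ_
    ; _⇨_ = _→ᶠ_
    ; ⊤ = ⊤ᶠ
    ; ⊥ = bot
    ; isHeytingAlgebra = record
      { isBoundedLattice = record
        { isLattice = record
          { isPartialOrder = record
            { isPreorder = record
              { isEquivalence = record
                { refl  = ≲-antisym id id
                ; sym   = λ d → ≲-antisym (∼⇒≳ d) (∼⇒≲ d)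
                ; trans = λ d e → ≲-antisym (≲-trans (∼⇒≲ d) (∼⇒≲ e))
                                            (≲-trans (∼⇒≳ e) (∼⇒≳ d))
                }
              ; reflexive = ∼⇒≲
              ; trans = ≲-trans
              }
            ; antisym = ≲-antisym
            }
          ; supremum = λ φ ψ → ∨R₁ id , ∨R₂ id , λ χ → ∨L
          ; infimum  = λ φ ψ → ∧L₁ id , ∧L₂ id , λ χ → ∧R
          }
        ; maximum = λ φ → →R id
        ; minimum = λ φ → ⊥L
        }
      ; exponential = λ φ ψ χ → curryᶠ , uncurryᶠ
      }
    }

  module Structure (𝐆 : Completion Lindenbaum) where
    open Completion 𝐆

    Valuation : Set ℓ
    Valuation = SVar → Tm → Carrier

    infixl 10 _[_/_]ⱽ
    _[_/_]ⱽ : Valuation → (Tm → Carrier) → SVar → Valuation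
    (𝒱 [ F / X ]ⱽ) Y with Y ≟ X
    ... | yes _ = F
    ... | no  _ = 𝒱 Y

    ⟦_⟧ᶜ : Conn → Op₂ Carrier
    ⟦ and ⟧ᶜ = _∧_
    ⟦ or  ⟧ᶜ = _∨_
    ⟦ imp ⟧ᶜ = _⇨_

    ⟦_⟧Q : Quant → Pred Carrier ℓ → Carrier
    ⟦ all ⟧Q = ⋀
    ⟦ ex  ⟧Q = ⋁

    -- ⟦ φ ⟧ 𝒱 ρ is the value 𝒱(φ[ρ]) of φ with its term variables evaluated by
    -- the substitution ρ, an environment in the term domain; the instance 𝒱(φ(t))
    -- of the body of a quantifier is reached by extending ρ with t.  The
    -- clauses for 𝒱(Qx.φ(x)) in terms of φ(t) are eval-quant and eval₀-quant.
    ⟦_⟧ : Fm → Valuation → Sub → Carrier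
    ⟦ rel p ts  ⟧ 𝒱 ρ = ι (rel p (ts [ ρ ]ᵗˢ))
    ⟦ X · t     ⟧ 𝒱 ρ = 𝒱 X (t [ ρ ]ᵗ)
    ⟦ bot       ⟧ 𝒱 ρ = ⊥
    ⟦ bin c φ ψ ⟧ 𝒱 ρ = ⟦ c ⟧ᶜ (⟦ φ ⟧ 𝒱 ρ) (⟦ ψ ⟧ 𝒱 ρ)
    ⟦ quant Q φ ⟧ 𝒱 ρ = ⟦ Q ⟧Q (range λ t → ⟦ φ ⟧ 𝒱 (t • ρ))

    ⟦_⟧₀ : FMP₀ → Valuation → Sub → Carrier
    ⟦ rel p ts       ⟧₀ 𝒱 ρ = ι (rel p (ts [ ρ ]ᵗˢ))
    ⟦ X · t          ⟧₀ 𝒱 ρ = 𝒱 X (t [ ρ ]ᵗ)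
    ⟦ bot            ⟧₀ 𝒱 ρ = ⊥
    ⟦ bin c φ ψ      ⟧₀ 𝒱 ρ = ⟦ c ⟧ᶜ (⟦ φ ⟧₀ 𝒱 ρ) (⟦ ψ ⟧₀ 𝒱 ρ)
    ⟦ quant Q φ      ⟧₀ 𝒱 ρ = ⟦ Q ⟧Q (range λ t → ⟦ φ ⟧₀ 𝒱 (t • ρ))
    ⟦ quant² Q X ξ _ ⟧₀ 𝒱 ρ =
      ⟦ Q ⟧Q (range λ (F : Tm → Carrier) → ⟦ ξ ⟧ (𝒱 [ F / X ]ⱽ) ρ)

    eval : Valuation → Fm → Carrier
    eval 𝒱 φ = ⟦ φ ⟧ 𝒱 var

    eval₀ : Valuation → FMP₀ → Carrier
    eval₀ 𝒱 φ = ⟦ φ ⟧₀ 𝒱 var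

    evalˢ : Valuation → List Fm → Carrier
    evalˢ 𝒱 Δ = ⋀ (image (eval 𝒱) (_∈ Δ))

    quant-cong : ∀ Q {I : Set ℓ} {f g : I → Carrier} → (∀ i → f i ≈ g i) →
                 ⟦ Q ⟧Q (range f) ≈ ⟦ Q ⟧Q (range g)
    quant-cong Q f≈g = antisym (mono Q f≈g) (mono Q (λ i → Eq.sym (f≈g i)))
      where
      transfer : ∀ {I : Set ℓ} {f g : I → Carrier} → (∀ i → f i ≈ g i) →
                 ∀ x → range f x → range g x
      transfer f≈g x (i , x≈fi) = i , Eq.trans x≈fi (f≈g i)

      mono : ∀ Q {I : Set ℓ} {f g : I → Carrier} → (∀ i → f i ≈ g i) →
             ⟦ Q ⟧Q (range f) ≤ ⟦ Q ⟧Q (range g)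
      mono all {f = f} {g} f≈g = proj₂ (⋀-inf (range g)) _ λ x x∈g →
        proj₁ (⋀-inf (range f)) x (transfer (λ i → Eq.sym (f≈g i)) x x∈g)
      mono ex {f = f} {g} f≈g = proj₂ (⋁-sup (range f)) _ λ x x∈f →
        proj₁ (⋁-sup (range g)) x (transfer f≈g x x∈f)

    conn-cong : ∀ c {x y u v} → x ≈ y → u ≈ v → ⟦ c ⟧ᶜ x u ≈ ⟦ c ⟧ᶜ y v
    conn-cong and = MeetProperties.∧-cong meetSemilattice
    conn-cong or  = JoinProperties.∨-cong joinSemilattice
    conn-cong imp = HeytingProperties.⇨-cong heytingAlgebra

    ⟦⟧-[] : ∀ φ 𝒱 {σ ρ τ} → (∀ n → σ n [ ρ ]ᵗ ≡ τ n) →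
            ⟦ φ [ σ ] ⟧ 𝒱 ρ ≈ ⟦ φ ⟧ 𝒱 τ
    ⟦⟧-[] (rel p ts)  𝒱 e = Eq.reflexive (cong (λ ts → ι (rel p ts)) ([]ᵗˢ-∘ e ts))
    ⟦⟧-[] (X · t)     𝒱 e = Eq.reflexive (cong (𝒱 X) ([]ᵗ-∘ e t))
    ⟦⟧-[] bot         𝒱 e = Eq.refl
    ⟦⟧-[] (bin c φ ψ) 𝒱 e = conn-cong c (⟦⟧-[] φ 𝒱 e) (⟦⟧-[] ψ 𝒱 e)
    ⟦⟧-[] (quant Q φ) 𝒱 {σ} e = quant-cong Q λ t → ⟦⟧-[] φ 𝒱 (lift-• {σ} e t)

    ⟦⟧₀-[] : ∀ φ 𝒱 {σ ρ τ} → (∀ n → σ n [ ρ ]ᵗ ≡ τ n) →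
             ⟦ φ [ σ ]₀ ⟧₀ 𝒱 ρ ≈ ⟦ φ ⟧₀ 𝒱 τ
    ⟦⟧₀-[] (rel p ts)  𝒱 e = Eq.reflexive (cong (λ ts → ι (rel p ts)) ([]ᵗˢ-∘ e ts))
    ⟦⟧₀-[] (X · t)     𝒱 e = Eq.reflexive (cong (𝒱 X) ([]ᵗ-∘ e t))
    ⟦⟧₀-[] bot         𝒱 e = Eq.refl
    ⟦⟧₀-[] (bin c φ ψ) 𝒱 e = conn-cong c (⟦⟧₀-[] φ 𝒱 e) (⟦⟧₀-[] ψ 𝒱 e)
    ⟦⟧₀-[] (quant Q φ) 𝒱 {σ} e = quant-cong Q λ t → ⟦⟧₀-[] φ 𝒱 (lift-• {σ} e t)
    ⟦⟧₀-[] (quant² Q X ξ _) 𝒱 e = quant-cong Q λ F → ⟦⟧-[] ξ (𝒱 [ F / X ]ⱽ) e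

    eval-quant : ∀ 𝒱 Q φ →
      eval 𝒱 (quant Q φ) ≈ ⟦ Q ⟧Q (range λ t → eval 𝒱 (φ ⟨ t ⟩))
    eval-quant 𝒱 Q φ = quant-cong Q λ t → Eq.sym (⟦⟧-[] φ 𝒱 (•-var t))

    eval₀-quant : ∀ 𝒱 Q φ →
      eval₀ 𝒱 (quant Q φ) ≈ ⟦ Q ⟧Q (range λ t → eval₀ 𝒱 (φ ⟨ t ⟩₀))
    eval₀-quant 𝒱 Q φ = quant-cong Q λ t → Eq.sym (⟦⟧₀-[] φ 𝒱 (•-var t))

    𝓘 : Valuation
    𝓘 X t = ι (X · t)

    module _ (X : SVar) (φ : Fm) (φ⊆X : FV φ ⊆ X ∷ []) where

      Condition₁ : Set ℓ
      Condition₁ = eval₀ 𝓘 (∀² X φ φ⊆X)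
        ≈ ⋁ (image ι (λ a → ι a ≤ eval₀ 𝓘 (∀² X φ φ⊆X)))

      Condition₂ : Set ℓ
      Condition₂ = eval₀ 𝓘 (∀² X φ φ⊆X)
        ≈ ⋁ (image (λ Δ → ι (⋀ᶠ Δ)) ∣∀² X , φ ∣₀)

      Condition₃ : Set ℓ
      Condition₃ = ∀ (y : Carrier) →
        (∀ Δ → ∣∀² X , φ ∣₀ Δ → evalˢ 𝓘 Δ ≤ y) → eval₀ 𝓘 (∀² X φ φ⊆X) ≤ y

-- Regularity gives 𝓘(ψ) = [ψ] for every first order ψ.  If Δ ∈ ∣∀X.φ∣₀ with
-- witness Y, soundness at 𝓘 with Y sent to an arbitrary F yields 𝓘(Δ) ≤ 𝓘(∀X.φ).
-- Conversely, if [a] ≤ 𝓘(∀X.φ), instantiating X by 𝓘(Y) for Y fresh for a gives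
-- [a] ≤ [φ(Y)], so a ⇒ φ(Y) is derivable, and by cut elimination {a} ∈ ∣∀X.φ∣₀.
-- Hence the lower bounds of 𝓘(∀X.φ) in 𝐋 and the classes [Δ] have the same
-- upper bounds.
module Submission where

open import Data.Empty using (⊥-elim)
open import Data.List.Base using (List; []; _∷_; map; concatMap)
open import Data.List.Extrema.Nat using (max; xs≤max)
open import Data.List.Membership.Propositional using (_∈_; _∉_; lose)
open import Data.List.Membership.Propositional.Properties
  using (∈-map⁻; ∈-++⁺ˡ; ∈-++⁺ʳ; ∈-concatMap⁺)
open import Data.List.Properties using (map-∘; map-cong; map-cong-local)
open import Data.List.Relation.Binary.Subset.Propositional using (_⊆_)
open import Data.List.Relation.Binary.Subset.Propositional.Properties
  using (∈-∷⁺ʳ; map⁺; ⊆-refl)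
import Data.List.Relation.Unary.All as All
open import Data.List.Relation.Unary.Any using (here; there)
open import Data.Maybe.Base as Maybe using (Maybe; just; nothing)
open import Data.Nat.Base using (ℕ; zero; suc)
open import Data.Nat.Properties using (_≟_; n≮n)
open import Data.Product.Base using (_×_; _,_; proj₁; proj₂; ∃-syntax)
open import Data.Sum.Base as Sum using (_⊎_; inj₁; inj₂)
open import Data.Vec.Base using (Vec; []; _∷_)
open import Function.Base using (_∘_)
open import Function.Bundles using (_⇔_; mk⇔)
open import Level using (_⊔_) renaming (suc to lsuc)
open import Relation.Binary.Construct.Interior.Symmetric
  using (SymInterior; _,_; lhs≤rhs; rhs≤lhs; isPartialOrder)
open import Relation.Binary.Lattice using (HeytingAlgebra)
import Relation.Binary.Lattice.Properties.HeytingAlgebra as HeytingProperties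
import Relation.Binary.Lattice.Properties.JoinSemilattice as JoinProperties
import Relation.Binary.Lattice.Properties.MeetSemilattice as MeetProperties
import Relation.Binary.Reasoning.PartialOrder as ≤-Reasoning
open import Relation.Binary.PropositionalEquality
  using (_≡_; _≢_; refl; sym; trans; cong; cong₂; subst; subst₂; module ≡-Reasoning)
open import Relation.Nullary.Decidable using (yes; no)
open import Relation.Unary using (Pred)
open import Defs

-- Fresh variables, substitution and eigenvariables.

fresh : ∀ (ns : List ℕ) → ∃[ n ] n ∉ ns
fresh ns = suc (max 0 ns) , λ n∈ns → n≮n _ (All.lookup (xs≤max 0 ns) n∈ns)

module Derivations {ℓ} (𝓛 : Language ℓ) where
  open Logic 𝓛

  ∈-unbind : ∀ {n} ns → suc n ∈ ns → n ∈ unbind ns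
  ∈-unbind (zero  ∷ ns) (there p)   = ∈-unbind ns p
  ∈-unbind (suc m ∷ ns) (here refl) = here refl
  ∈-unbind (suc m ∷ ns) (there p)   = there (∈-unbind ns p)

  mutual
    []ᵗ-local : ∀ {σ τ} t → (∀ n → n ∈ fvᵗ t → σ n ≡ τ n) → t [ σ ]ᵗ ≡ t [ τ ]ᵗ
    []ᵗ-local (var n)   e = e n (here refl)
    []ᵗ-local (fn f ts) e = cong (fn f) ([]ᵗˢ-local ts e)

    []ᵗˢ-local : ∀ {σ τ n} (ts : Vec Tm n) →
                 (∀ n → n ∈ fvᵗˢ ts → σ n ≡ τ n) → ts [ σ ]ᵗˢ ≡ ts [ τ ]ᵗˢ
    []ᵗˢ-local []       e = refl
    []ᵗˢ-local (t ∷ ts) e = cong₂ _∷_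
      ([]ᵗ-local t λ n p → e n (∈-++⁺ˡ p))
      ([]ᵗˢ-local ts λ n p → e n (∈-++⁺ʳ (fvᵗ t) p))

  []-local : ∀ {σ τ} φ → (∀ n → n ∈ fv φ → σ n ≡ τ n) → φ [ σ ] ≡ φ [ τ ]
  []-local (rel p ts)  e = cong (rel p) ([]ᵗˢ-local ts e)
  []-local (X · t)     e = cong (X ·_) ([]ᵗ-local t e)
  []-local bot         e = refl
  []-local (bin c φ ψ) e = cong₂ (bin c)
    ([]-local φ λ n p → e n (∈-++⁺ˡ p))
    ([]-local ψ λ n p → e n (∈-++⁺ʳ (fv φ) p))
  []-local {σ} {τ} (quant Q φ) e = cong (quant Q) ([]-local φ e′)
    where
    e′ : ∀ n → n ∈ fv φ → lift σ n ≡ lift τ n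
    e′ zero    p = refl
    e′ (suc n) p = cong (_[ var ∘ suc ]ᵗ) (e n (∈-unbind (fv φ) p))

  lift-id : ∀ n → lift var n ≡ var n
  lift-id zero    = refl
  lift-id (suc n) = refl

  []-id : ∀ φ → φ [ var ] ≡ φ
  []-id (rel p ts)  = cong (rel p) ([]ᵗˢ-id ts)
  []-id (X · t)     = cong (X ·_) ([]ᵗ-id t)
  []-id bot         = refl
  []-id (bin c φ ψ) = cong₂ (bin c) ([]-id φ) ([]-id ψ)
  []-id (quant Q φ) =
    cong (quant Q) (trans ([]-local φ λ n _ → lift-id n) ([]-id φ))

  lift-∘ : ∀ {σ ρ τ} → (∀ n → σ n [ ρ ]ᵗ ≡ τ n) →
           ∀ n → lift σ n [ lift ρ ]ᵗ ≡ lift τ n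
  lift-∘     e zero    = refl
  lift-∘ {σ} {ρ} {τ} e (suc n) = begin
    σ n [ var ∘ suc ]ᵗ [ lift ρ ]ᵗ ≡⟨ []ᵗ-∘ (λ _ → refl) (σ n) ⟩
    σ n [ lift ρ ∘ suc ]ᵗ          ≡⟨ []ᵗ-∘ (λ _ → refl) (σ n) ⟨
    σ n [ ρ ]ᵗ [ var ∘ suc ]ᵗ      ≡⟨ cong (_[ var ∘ suc ]ᵗ) (e n) ⟩
    τ n [ var ∘ suc ]ᵗ             ∎
    where open ≡-Reasoning

  -- The composite enters as any `τ` that agrees with it pointwise, so that passing under a
  -- quantifier needs no function extensionality.
  []-∘ : ∀ {σ ρ τ} → (∀ n → σ n [ ρ ]ᵗ ≡ τ n) → ∀ φ → φ [ σ ] [ ρ ] ≡ φ [ τ ]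
  []-∘ e (rel p ts)  = cong (rel p) ([]ᵗˢ-∘ e ts)
  []-∘ e (X · t)     = cong (X ·_) ([]ᵗ-∘ e t)
  []-∘ e bot         = refl
  []-∘ e (bin c φ ψ) = cong₂ (bin c) ([]-∘ e φ) ([]-∘ e ψ)
  []-∘ {σ} e (quant Q φ) = cong (quant Q) ([]-∘ (lift-∘ {σ} e) φ)

  lift-⟨⟩ : ∀ φ σ t → φ [ lift σ ] ⟨ t ⟩ ≡ φ [ t • σ ]
  lift-⟨⟩ φ σ t = []-∘ (lift-• {σ} (λ n → []ᵗ-id (σ n)) t) φ

  •-∘ : ∀ t σ n → (t • var) n [ σ ]ᵗ ≡ (t [ σ ]ᵗ • σ) n
  •-∘ t σ zero    = refl
  •-∘ t σ (suc n) = refl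

  ⟨⟩-[] : ∀ φ σ t → φ ⟨ t ⟩ [ σ ] ≡ φ [ lift σ ] ⟨ t [ σ ]ᵗ ⟩
  ⟨⟩-[] φ σ t = trans ([]-∘ (•-∘ t σ) φ) (sym (lift-⟨⟩ φ σ _))

  ↑-lift : ∀ φ σ → ↑ φ [ lift σ ] ≡ ↑ (φ [ σ ])
  ↑-lift φ σ = trans ([]-∘ (λ _ → refl) φ) (sym ([]-∘ (λ _ → refl) φ))

  map-↑-lift : ∀ Γ σ → map (_[ lift σ ]) (map ↑ Γ) ≡ map ↑ (map (_[ σ ]) Γ)
  map-↑-lift Γ σ = begin
    map (_[ lift σ ]) (map ↑ Γ)  ≡⟨ map-∘ Γ ⟨
    map (λ φ → ↑ φ [ lift σ ]) Γ ≡⟨ map-cong (λ φ → ↑-lift φ σ) Γ ⟩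
    map (λ φ → ↑ (φ [ σ ])) Γ    ≡⟨ map-∘ Γ ⟩
    map ↑ (map (_[ σ ]) Γ)       ∎
    where open ≡-Reasoning

  mapᴹ-↑-lift : ∀ Π σ →
    Maybe.map (_[ lift σ ]) (Maybe.map ↑ Π) ≡ Maybe.map ↑ (Maybe.map (_[ σ ]) Π)
  mapᴹ-↑-lift nothing  σ = refl
  mapᴹ-↑-lift (just φ) σ = cong just (↑-lift φ σ)

  module _ {m : Mode} where

    -- Eigenvariables survive because `lift σ` fixes index 0 and commutes with the shift of the side
    -- formulas. Every rule is mapped to itself, so cut-free derivations stay cut-free.
    ⊢-[] : ∀ {Γ Π} σ → m ⊢ Γ ⇒ Π → m ⊢ map (_[ σ ]) Γ ⇒ Maybe.map (_[ σ ]) Π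
    ⊢-[] σ id         = id
    ⊢-[] σ (cut e d d′) = cut e (⊢-[] σ d) (⊢-[] σ d′)
    ⊢-[] σ (wkL s d)  = wkL (map⁺ _ s) (⊢-[] σ d)
    ⊢-[] σ (wkR d)    = wkR (⊢-[] σ d)
    ⊢-[] σ ⊥L         = ⊥L
    ⊢-[] σ (∧L₁ d)    = ∧L₁ (⊢-[] σ d)
    ⊢-[] σ (∧L₂ d)    = ∧L₂ (⊢-[] σ d)
    ⊢-[] σ (∧R d d′)  = ∧R (⊢-[] σ d) (⊢-[] σ d′)
    ⊢-[] σ (∨L d d′)  = ∨L (⊢-[] σ d) (⊢-[] σ d′)
    ⊢-[] σ (∨R₁ d)    = ∨R₁ (⊢-[] σ d)
    ⊢-[] σ (∨R₂ d)    = ∨R₂ (⊢-[] σ d)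
    ⊢-[] σ (→L d d′)  = →L (⊢-[] σ d) (⊢-[] σ d′)
    ⊢-[] σ (→R d)     = →R (⊢-[] σ d)
    ⊢-[] σ (∀L {φ = φ} t d) =
      ∀L (t [ σ ]ᵗ) (subst (λ χ → m ⊢ χ ∷ _ ⇒ _) (⟨⟩-[] φ σ t) (⊢-[] σ d))
    ⊢-[] σ (∀R {Γ = Γ} d) =
      ∀R (subst (m ⊢_⇒ _) (map-↑-lift Γ σ) (⊢-[] (lift σ) d))
    ⊢-[] σ (∃L {Γ = Γ} {φ} {Π} d) =
      ∃L (subst₂ (λ Γ Π → m ⊢ φ [ lift σ ] ∷ Γ ⇒ Π)
           (map-↑-lift Γ σ) (mapᴹ-↑-lift Π σ) (⊢-[] (lift σ) d))
    ⊢-[] σ (∃R {φ = φ} t d) =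
      ∃R (t [ σ ]ᵗ) (subst (λ χ → m ⊢ _ ⇒ just χ) (⟨⟩-[] φ σ t) (⊢-[] σ d))

    -- Left rules act on a head formula; this supplies a head copy of a member of the context.
    contract : ∀ {Γ φ Π} → φ ∈ Γ → m ⊢ φ ∷ Γ ⇒ Π → m ⊢ Γ ⇒ Π
    contract φ∈Γ = wkL (∈-∷⁺ʳ φ∈Γ ⊆-refl)

  -- The renaming that turns the variable y into the eigenvariable 0.
  bind : ℕ → Sub
  bind y n with n ≟ y
  ... | yes _ = var 0
  ... | no  _ = var (suc n)

  bind-eq : ∀ y → bind y y ≡ var 0
  bind-eq y with y ≟ y
  ... | yes _  = refl
  ... | no y≢y = ⊥-elim (y≢y refl)

  bind-fresh : ∀ {y ns} → y ∉ ns → ∀ n → n ∈ ns → bind y n ≡ var (suc n)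
  bind-fresh {y} y∉ns n n∈ns with n ≟ y
  ... | yes refl = ⊥-elim (y∉ns n∈ns)
  ... | no  _    = refl

  []-bind : ∀ {y} φ → y ∉ fv φ → φ [ bind y ] ≡ ↑ φ
  []-bind φ y∉φ = []-local φ (bind-fresh y∉φ)

  -- Instantiating index 0 by `y` lowers the other indices by one; `bind y` raises them again and
  -- sends `y` back to 0. Freshness keeps the other variables of the body apart from `y`.
  ⟨⟩-bind : ∀ {y} φ → y ∉ unbind (fv φ) → φ ⟨ var y ⟩ [ bind y ] ≡ φ
  ⟨⟩-bind {y} φ y∉φ =
    trans ([]-∘ (•-∘ (var y) (bind y)) φ) (trans ([]-local φ e) ([]-id φ))
    where
    e : ∀ n → n ∈ fv φ → (bind y y • bind y) n ≡ var n
    e zero    p = bind-eq y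
    e (suc n) p = bind-fresh y∉φ n (∈-unbind (fv φ) p)

  map-bind : ∀ {y} Γ → (∀ {φ} → φ ∈ Γ → y ∉ fv φ) → map (_[ bind y ]) Γ ≡ map ↑ Γ
  map-bind Γ y∉Γ = map-cong-local (All.tabulate λ {φ} φ∈Γ → []-bind φ (y∉Γ φ∈Γ))

  fresh-for : ∀ Γ → ∃[ y ] (∀ {φ} → φ ∈ Γ → y ∉ fv φ)
  fresh-for Γ with fresh (concatMap fv Γ)
  ... | y , y∉ = y , λ φ∈Γ y∈φ → y∉ (∈-concatMap⁺ fv (lose φ∈Γ y∈φ))

  module _ {m : Mode} where

    -- Semantic quantifiers supply a derivation for every term. The one at a fresh `y`, renamed by
    -- `bind y`, is the premise of `∀R`, and likewise for `∃L-instances`.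
    ∀R-instances : ∀ {Γ φ} → (∀ t → m ⊢ Γ ⇒ just (φ ⟨ t ⟩)) → m ⊢ Γ ⇒ just (∀ᶠ φ)
    ∀R-instances {Γ} {φ} d with fresh-for (∀ᶠ φ ∷ Γ)
    ... | y , y∉ = ∀R (subst₂ (λ Γ φ → m ⊢ Γ ⇒ just φ)
      (map-bind Γ (y∉ ∘ there)) (⟨⟩-bind φ (y∉ (here refl)))
      (⊢-[] (bind y) (d (var y))))

    ∃L-instances : ∀ {Γ φ Π} → (∀ t → m ⊢ φ ⟨ t ⟩ ∷ Γ ⇒ Π) → m ⊢ ∃ᶠ φ ∷ Γ ⇒ Π
    ∃L-instances {Γ} {φ} {nothing} d with fresh-for (∃ᶠ φ ∷ Γ)
    ... | y , y∉ = ∃L (subst₂ (λ Γ φ → m ⊢ φ ∷ Γ ⇒ nothing)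
      (map-bind Γ (y∉ ∘ there)) (⟨⟩-bind φ (y∉ (here refl)))
      (⊢-[] (bind y) (d (var y))))
    ∃L-instances {Γ} {φ} {just ψ} d with fresh-for (∃ᶠ φ ∷ ψ ∷ Γ)
    ... | y , y∉ = ∃L (subst₂ (λ Γ φψ → m ⊢ proj₁ φψ ∷ Γ ⇒ just (proj₂ φψ))
      (map-bind Γ (λ p → y∉ (there (there p))))
      (cong₂ _,_ (⟨⟩-bind φ (y∉ (here refl))) ([]-bind ψ (y∉ (there (here refl)))))
      (⊢-[] (bind y) (d (var y))))

-- Soundness in a Heyting algebra.

module Soundness {ℓ} (𝓛 : Language ℓ) where
  open Logic 𝓛
  open Derivations 𝓛

  -- Instead of completeness of `H`, the meets and joins over terms are assumed to exist. One
  -- soundness proof then serves both the completion and the algebra of closed sets, whose carrier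
  -- lies a universe above its order.
  record Interpretation {c ℓ₁ ℓ₂} (H : HeytingAlgebra c ℓ₁ ℓ₂) :
                        Set (ℓ ⊔ c ⊔ ℓ₁ ⊔ ℓ₂) where
    open HeytingAlgebra H renaming (refl to ≤-refl; trans to ≤-trans)
    open HeytingProperties H using (⇨-eval; swap-transpose-⇨)
    field
      ⟦_⟧   : Fm → Sub → Carrier
      ⟦bot⟧ : ∀ {ρ} → ⟦ bot ⟧ ρ ≈ ⊥
      ⟦∧⟧   : ∀ {φ ψ ρ} → ⟦ φ ∧ᶠ ψ ⟧ ρ ≈ ⟦ φ ⟧ ρ ∧ ⟦ ψ ⟧ ρ
      ⟦∨⟧   : ∀ {φ ψ ρ} → ⟦ φ ∨ᶠ ψ ⟧ ρ ≈ ⟦ φ ⟧ ρ ∨ ⟦ ψ ⟧ ρ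
      ⟦→⟧   : ∀ {φ ψ ρ} → ⟦ φ →ᶠ ψ ⟧ ρ ≈ ⟦ φ ⟧ ρ ⇨ ⟦ ψ ⟧ ρ
      ⟦∀⟧   : ∀ {φ ρ} → IsInf _≤_ (λ x → ∃[ t ] x ≈ ⟦ φ ⟧ (t • ρ)) (⟦ ∀ᶠ φ ⟧ ρ)
      ⟦∃⟧   : ∀ {φ ρ} → IsSup _≤_ (λ x → ∃[ t ] x ≈ ⟦ φ ⟧ (t • ρ)) (⟦ ∃ᶠ φ ⟧ ρ)
      ⟦[]⟧  : ∀ φ {σ ρ τ} → (∀ n → σ n [ ρ ]ᵗ ≡ τ n) → ⟦ φ [ σ ] ⟧ ρ ≈ ⟦ φ ⟧ τ

    ⟦_⟧ᴹ : Maybe Fm → Sub → Carrier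
    ⟦ nothing ⟧ᴹ ρ = ⊥
    ⟦ just φ  ⟧ᴹ ρ = ⟦ φ ⟧ ρ

    infix 4 _≤⟦_⟧_
    -- Stands for a bound by the meet of the antecedent; order and multiplicity disappear, and
    -- weakening becomes composition with an inclusion.
    _≤⟦_⟧_ : Carrier → List Fm → Sub → Set (ℓ ⊔ ℓ₂)
    x ≤⟦ Γ ⟧ ρ = ∀ {φ} → φ ∈ Γ → x ≤ ⟦ φ ⟧ ρ

    private
      infixr 5 _∷ʰ_
      _∷ʰ_ : ∀ {x φ Γ ρ} → x ≤ ⟦ φ ⟧ ρ → x ≤⟦ Γ ⟧ ρ → x ≤⟦ φ ∷ Γ ⟧ ρ
      (p ∷ʰ h) (here refl) = p
      (p ∷ʰ h) (there q)   = h q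

      ≤-≈-trans : ∀ {x y z} → x ≤ y → y ≈ z → x ≤ z
      ≤-≈-trans p q = ≤-trans p (reflexive q)

      apply : ∀ {x y z} → x ≤ y → x ≤ y ⇨ z → x ≤ z
      apply p q = ≤-trans (∧-greatest q p) ⇨-eval

      -- Moving the context `x` into an implication lets the universal property of a join `y` apply.
      -- This is how distributivity of meets over joins enters the rules `∨L` and `∃L`.
      eliminate : ∀ {x y z} → x ≤ y → y ≤ x ⇨ z → x ≤ z
      eliminate p q = ≤-trans (∧-greatest p ≤-refl) (transpose-∧ q)

      under : ∀ {x φ Γ ρ} → x ≤⟦ Γ ⟧ ρ → ⟦ φ ⟧ ρ ∧ x ≤⟦ φ ∷ Γ ⟧ ρ
      under h = x∧y≤x _ _ ∷ʰ λ p → ≤-trans (x∧y≤y _ _) (h p)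

      ≤⟦↑⟧ : ∀ {x Γ ρ} t → x ≤⟦ Γ ⟧ ρ → x ≤⟦ map ↑ Γ ⟧ (t • ρ)
      ≤⟦↑⟧ t h p with ∈-map⁻ ↑ p
      ... | ψ , ψ∈Γ , refl = ≤-≈-trans (h ψ∈Γ) (Eq.sym (⟦[]⟧ ψ λ _ → refl))

      ⟦↑⟧ᴹ : ∀ Π {t ρ} → ⟦ Maybe.map ↑ Π ⟧ᴹ (t • ρ) ≤ ⟦ Π ⟧ᴹ ρ
      ⟦↑⟧ᴹ nothing  = ≤-refl
      ⟦↑⟧ᴹ (just φ) = reflexive (⟦[]⟧ φ λ _ → refl)

      ⟦⟨⟩⟧ : ∀ φ t {ρ} → ⟦ φ ⟨ t ⟩ ⟧ ρ ≈ ⟦ φ ⟧ (t [ ρ ]ᵗ • ρ)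
      ⟦⟨⟩⟧ φ t {ρ} = ⟦[]⟧ φ (•-∘ t ρ)

    -- Both `ρ` and `x` vary in the induction: eigenvariable rules extend the environment by each
    -- term, and discharging an assumption replaces the bound by its meet with the value of that
    -- assumption.
    sound : ∀ {m Γ Π ρ x} → m ⊢ Γ ⇒ Π → x ≤⟦ Γ ⟧ ρ → x ≤ ⟦ Π ⟧ᴹ ρ
    sound id          h = h (here refl)
    sound (cut _ d e) h = sound e (sound d h ∷ʰ h)
    sound (wkL s d)   h = sound d (h ∘ s)
    sound (wkR d)     h = ≤-trans (sound d h) (minimum _)
    sound ⊥L          h = ≤-trans (≤-≈-trans (h (here refl)) ⟦bot⟧) (minimum _)
    sound (∧L₁ d)     h = sound d
      (≤-trans (≤-≈-trans (h (here refl)) ⟦∧⟧) (x∧y≤x _ _) ∷ʰ h ∘ there)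
    sound (∧L₂ d)     h = sound d
      (≤-trans (≤-≈-trans (h (here refl)) ⟦∧⟧) (x∧y≤y _ _) ∷ʰ h ∘ there)
    sound (∧R d e)    h = ≤-≈-trans (∧-greatest (sound d h) (sound e h)) (Eq.sym ⟦∧⟧)
    sound (∨L d e)    h = eliminate (≤-≈-trans (h (here refl)) ⟦∨⟧)
      (∨-least (transpose-⇨ (sound d (under (h ∘ there))))
               (transpose-⇨ (sound e (under (h ∘ there)))))
    sound (∨R₁ d)     h = ≤-≈-trans (≤-trans (sound d h) (x≤x∨y _ _)) (Eq.sym ⟦∨⟧)
    sound (∨R₂ d)     h = ≤-≈-trans (≤-trans (sound d h) (y≤x∨y _ _)) (Eq.sym ⟦∨⟧)
    sound (→L d e)    h = sound e
      (apply (sound d (h ∘ there)) (≤-≈-trans (h (here refl)) ⟦→⟧) ∷ʰ h ∘ there)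
    sound (→R d)      h = ≤-≈-trans (swap-transpose-⇨ (sound d (under h))) (Eq.sym ⟦→⟧)
    sound (∀L {φ = φ} t d) h = sound d
      (≤-trans (h (here refl)) (proj₁ ⟦∀⟧ _ (_ , ⟦⟨⟩⟧ φ t)) ∷ʰ h ∘ there)
    sound (∀R d)      h = proj₂ ⟦∀⟧ _ λ { y (t , y≈) →
      ≤-≈-trans (sound d (≤⟦↑⟧ t h)) (Eq.sym y≈) }
    sound (∃L {Π = Π} d) h = eliminate (h (here refl))
      (proj₂ ⟦∃⟧ _ λ { y (t , y≈) → ≤-trans (reflexive y≈) (transpose-⇨
        (≤-trans (sound d (under (≤⟦↑⟧ t (h ∘ there)))) (⟦↑⟧ᴹ Π))) })
    sound (∃R {φ = φ} t d) h =
      ≤-trans (≤-≈-trans (sound d h) (⟦⟨⟩⟧ φ t)) (proj₁ ⟦∃⟧ _ (_ , Eq.refl))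

-- Okada's semantic cut elimination: a formula φ is interpreted by a closed set of
-- contexts that contains every context containing φ (reflect) and consists of
-- contexts deriving φ without cut (reify).
module CutElimination {ℓ} (𝓛 : Language ℓ) where
  open import Data.Empty.Polymorphic using (⊥)
  open import Data.Unit.Polymorphic using (⊤)
  open Logic 𝓛
  open Derivations 𝓛
  open Soundness 𝓛

  -- Biorthogonal closure with respect to cut-free derivability; it quantifies
  -- over sequents only, so closed sets of level ℓ have all meets and joins
  -- indexed by terms.
  Closure : Pred (List Fm) ℓ → Pred (List Fm) ℓ
  Closure U Γ = ∀ {Δ Π} → Γ ⊆ Δ →
    (∀ {Θ} → Δ ⊆ Θ → U Θ → LI⊢ᶜᶠ Θ ⇒ Π) → LI⊢ᶜᶠ Δ ⇒ Π

  record Closed : Set (lsuc ℓ) where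
    field
      holds  : Pred (List Fm) ℓ
      mono   : ∀ {Γ Δ} → Γ ⊆ Δ → holds Γ → holds Δ
      closed : ∀ {Γ} → Closure holds Γ → holds Γ

  open Closed

  closure : Pred (List Fm) ℓ → Closed
  closure U = record
    { holds  = Closure U
    ; mono   = λ s c s′ → c (s′ ∘ s)
    ; closed = λ c s k → c s λ s′ c′ → c′ ⊆-refl λ s″ → k (s″ ∘ s′)
    }

  -- The Heyting algebra of closed sets.

  infix 4 _≤_
  _≤_ : Closed → Closed → Set ℓ
  U ≤ V = ∀ Γ → holds U Γ → holds V Γ

  ⋂ : {I : Set ℓ} → (I → Closed) → Closed
  ⋂ U = record
    { holds  = λ Γ → ∀ i → holds (U i) Γ
    ; mono   = λ s u i → mono (U i) s (u i)
    ; closed = λ c i → closed (U i) λ s k → c s λ s′ u → k s′ (u i)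
    }

  ⋃ : {I : Set ℓ} → (I → Closed) → Closed
  ⋃ U = closure λ Γ → ∃[ i ] holds (U i) Γ

  _⊓_ _⊔ᶜ_ _⇛_ : Closed → Closed → Closed
  U ⊓ V = record
    { holds  = λ Γ → holds U Γ × holds V Γ
    ; mono   = λ s (u , v) → mono U s u , mono V s v
    ; closed = λ c → closed U (λ s k → c s λ s′ (u , _) → k s′ u)
                   , closed V (λ s k → c s λ s′ (_ , v) → k s′ v)
    }
  U ⊔ᶜ V = closure λ Γ → holds U Γ ⊎ holds V Γ
  U ⇛ V = record
    { holds  = λ Γ → ∀ {Δ} → Γ ⊆ Δ → holds U Δ → holds V Δ
    ; mono   = λ s f s′ → f (s′ ∘ s)
    ; closed = λ c s u → closed V λ s′ k → c (s′ ∘ s) λ s″ f →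
                 k s″ (f ⊆-refl (mono U (s″ ∘ s′) u))
    }

  ⊥ᶜ ⊤ᶜ : Closed
  ⊥ᶜ = closure λ _ → ⊥
  ⊤ᶜ = record { holds = λ _ → ⊤ ; mono = _ ; closed = _ }

  -- Testing the closure against the right side `just φ` gives closedness.
  atom : Fm → Closed
  atom φ = record
    { holds  = λ Γ → LI⊢ᶜᶠ Γ ⇒ just φ
    ; mono   = wkL
    ; closed = λ c → c ⊆-refl λ _ d → d
    }

  closure-least : ∀ {U} V → (∀ Γ → U Γ → holds V Γ) → closure U ≤ V
  closure-least V f Γ c = closed V λ s k → c s λ s′ u → k s′ (f _ u)

  ⋃-upper : ∀ {I : Set ℓ} (U : I → Closed) i → U i ≤ ⋃ U
  ⋃-upper U i Γ u s k = k ⊆-refl (i , mono (U i) s u)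

  closedSets : HeytingAlgebra (lsuc ℓ) ℓ ℓ
  closedSets = record
    { Carrier = Closed
    ; _≈_ = SymInterior _≤_
    ; _≤_ = _≤_
    ; _∨_ = _⊔ᶜ_
    ; _∧_ = _⊓_
    ; _⇨_ = _⇛_
    ; ⊤ = ⊤ᶜ
    ; ⊥ = ⊥ᶜ
    ; isHeytingAlgebra = record
      { isBoundedLattice = record
        { isLattice = record
          { isPartialOrder = isPartialOrder (λ _ u → u) (λ f g Γ → g Γ ∘ f Γ)
          ; supremum = λ U V →
              (λ Γ u s k → k ⊆-refl (inj₁ (mono U s u))) ,
              (λ Γ v s k → k ⊆-refl (inj₂ (mono V s v))) ,
              λ W f g → closure-least W λ Γ → Sum.[ f Γ , g Γ ]
          ; infimum = λ U V →
              (λ Γ → proj₁) , (λ Γ → proj₂) , λ W f g Γ w → f Γ w , g Γ w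
          }
        ; maximum = λ _ _ _ → _
        ; minimum = λ U → closure-least U λ _ ()
        }
      ; exponential = λ U V W →
          (λ f Γ u s v → f _ (mono U s u , v)) ,
          (λ f Γ (u , v) → f Γ u ⊆-refl v)
      }
    }

  open HeytingAlgebra closedSets using (_≈_; module Eq; meetSemilattice; joinSemilattice)

  ⋂-cong : ∀ {I : Set ℓ} {U V : I → Closed} → (∀ i → U i ≈ V i) → ⋂ U ≈ ⋂ V
  ⋂-cong e = (λ Γ u i → lhs≤rhs (e i) Γ (u i)) , (λ Γ v i → rhs≤lhs (e i) Γ (v i))

  ⋃-cong : ∀ {I : Set ℓ} {U V : I → Closed} → (∀ i → U i ≈ V i) → ⋃ U ≈ ⋃ V
  ⋃-cong {U = U} {V} e =
    closure-least (⋃ V) (λ Γ (i , u) → ⋃-upper V i Γ (lhs≤rhs (e i) Γ u)) ,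
    closure-least (⋃ U) (λ Γ (i , v) → ⋃-upper U i Γ (rhs≤lhs (e i) Γ v))

  -- Interpretation by closed sets and cut elimination.

  ⟦_⟧ : Fm → Sub → Closed
  ⟦ rel p ts ⟧ ρ = atom (rel p ts [ ρ ])
  ⟦ X · t    ⟧ ρ = atom (X · t [ ρ ])
  ⟦ bot      ⟧ ρ = ⊥ᶜ
  ⟦ φ ∧ᶠ ψ   ⟧ ρ = ⟦ φ ⟧ ρ ⊓ ⟦ ψ ⟧ ρ
  ⟦ φ ∨ᶠ ψ   ⟧ ρ = ⟦ φ ⟧ ρ ⊔ᶜ ⟦ ψ ⟧ ρ
  ⟦ φ →ᶠ ψ   ⟧ ρ = ⟦ φ ⟧ ρ ⇛ ⟦ ψ ⟧ ρ
  ⟦ ∀ᶠ φ     ⟧ ρ = ⋂ λ t → ⟦ φ ⟧ (t • ρ)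
  ⟦ ∃ᶠ φ     ⟧ ρ = ⋃ λ t → ⟦ φ ⟧ (t • ρ)

  ⟦⟧-[]ᶜ : ∀ φ {σ ρ τ} → (∀ n → σ n [ ρ ]ᵗ ≡ τ n) → ⟦ φ [ σ ] ⟧ ρ ≈ ⟦ φ ⟧ τ
  ⟦⟧-[]ᶜ (rel p ts) e = Eq.reflexive (cong atom ([]-∘ e (rel p ts)))
  ⟦⟧-[]ᶜ (X · t)    e = Eq.reflexive (cong atom ([]-∘ e (X · t)))
  ⟦⟧-[]ᶜ bot        e = Eq.refl
  ⟦⟧-[]ᶜ (φ ∧ᶠ ψ)   e = MeetProperties.∧-cong meetSemilattice (⟦⟧-[]ᶜ φ e) (⟦⟧-[]ᶜ ψ e)
  ⟦⟧-[]ᶜ (φ ∨ᶠ ψ)   e = JoinProperties.∨-cong joinSemilattice (⟦⟧-[]ᶜ φ e) (⟦⟧-[]ᶜ ψ e)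
  ⟦⟧-[]ᶜ (φ →ᶠ ψ)   e = HeytingProperties.⇨-cong closedSets (⟦⟧-[]ᶜ φ e) (⟦⟧-[]ᶜ ψ e)
  ⟦⟧-[]ᶜ (∀ᶠ φ) {σ} e = ⋂-cong λ t → ⟦⟧-[]ᶜ φ (lift-• {σ} e t)
  ⟦⟧-[]ᶜ (∃ᶠ φ) {σ} e = ⋃-cong λ t → ⟦⟧-[]ᶜ φ (lift-• {σ} e t)

  interpretation : Interpretation closedSets
  interpretation = record
    { ⟦_⟧   = ⟦_⟧
    ; ⟦bot⟧ = Eq.refl
    ; ⟦∧⟧   = Eq.refl
    ; ⟦∨⟧   = Eq.refl
    ; ⟦→⟧   = Eq.refl
    ; ⟦∀⟧   = (λ { U (t , e) Γ u → rhs≤lhs e Γ (u t) })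
            , (λ L f Γ l t → f _ (t , Eq.refl) Γ l)
    ; ⟦∃⟧   = λ {φ} {ρ} →
              (λ { U (t , e) Γ u → ⋃-upper (λ t → ⟦ φ ⟧ (t • ρ)) t Γ (lhs≤rhs e Γ u) })
            , (λ V f → closure-least V λ { Γ (t , u) → f _ (t , Eq.refl) Γ u })
    ; ⟦[]⟧  = ⟦⟧-[]ᶜ
    }

  mutual
    -- Closedness reduces a compound case to deriving an arbitrary right side, where the left rule
    -- of the connective applies and `k` closes the premise from the reflected subformula.
    -- Implication also reifies its hypothesis, whence the mutual induction.
    reflect : ∀ φ {ρ Γ} → φ [ ρ ] ∈ Γ → holds (⟦ φ ⟧ ρ) Γ
    reflect (rel p ts) x = contract x id
    reflect (X · t)    x = contract x id
    reflect bot        x s k = contract (s x) ⊥L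
    reflect (φ ∧ᶠ ψ) {ρ} x =
      closed (⟦ φ ⟧ ρ) (λ s k → contract (s x) (∧L₁ (k there (reflect φ (here refl))))) ,
      closed (⟦ ψ ⟧ ρ) (λ s k → contract (s x) (∧L₂ (k there (reflect ψ (here refl)))))
    reflect (φ ∨ᶠ ψ) x s k = contract (s x)
      (∨L (k there (inj₁ (reflect φ (here refl))))
          (k there (inj₂ (reflect ψ (here refl)))))
    reflect (φ →ᶠ ψ) {ρ} x s u = closed (⟦ ψ ⟧ ρ) λ s′ k → contract (s′ (s x))
      (→L (wkL s′ (reify φ u)) (k there (reflect ψ (here refl))))
    reflect (∀ᶠ φ) {ρ} x t = closed (⟦ φ ⟧ (t • ρ)) λ s k → contract (s x)
      (∀L t (k there (reflect φ (here (sym (lift-⟨⟩ φ ρ t))))))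
    reflect (∃ᶠ φ) {ρ} x s k = contract (s x)
      (∃L-instances λ t → k there (t , reflect φ (here (sym (lift-⟨⟩ φ ρ t)))))

    -- Each compound case but `bot` ends in the right rule of the connective. Values that are
    -- closures, those of `bot`, disjunctions and existentials, are opened by testing them against
    -- the formula itself as right side.
    reify : ∀ φ {ρ Γ} → holds (⟦ φ ⟧ ρ) Γ → LI⊢ᶜᶠ Γ ⇒ just (φ [ ρ ])
    reify (rel p ts) d = d
    reify (X · t)    d = d
    reify bot        u = u ⊆-refl λ _ ()
    reify (φ ∧ᶠ ψ)   (u , v) = ∧R (reify φ u) (reify ψ v)
    reify (φ ∨ᶠ ψ)   u = u ⊆-refl λ _ → Sum.[ ∨R₁ ∘ reify φ , ∨R₂ ∘ reify ψ ]
    reify (φ →ᶠ ψ)   f = →R (reify ψ (f there (reflect φ (here refl))))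
    reify (∀ᶠ φ) {ρ} u = ∀R-instances λ t →
      subst (λ χ → LI⊢ᶜᶠ _ ⇒ just χ) (sym (lift-⟨⟩ φ ρ t)) (reify φ (u t))
    reify (∃ᶠ φ) {ρ} u = u ⊆-refl λ { _ (t , v) →
      ∃R t (subst (λ χ → LI⊢ᶜᶠ _ ⇒ just χ) (sym (lift-⟨⟩ φ ρ t)) (reify φ v)) }

  open Interpretation interpretation using (sound)

  -- By `reflect`, the context `Γ` lies in the value of each of its members. Soundness, which
  -- absorbs cuts, carries it into the value of `φ`, where `reify` reads off a cut-free derivation.
  cut-elimination : ∀ {Γ φ} → LI⊢ Γ ⇒ just φ → LI⊢ᶜᶠ Γ ⇒ just φ
  cut-elimination {Γ} {φ} d = subst (λ χ → LI⊢ᶜᶠ Γ ⇒ just χ) ([]-id φ)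
    (reify φ (sound {x = ⋂ λ ((ψ , _) : ∃[ ψ ] ψ ∈ Γ) → ⟦ ψ ⟧ var} d
      (λ ψ∈Γ Δ u → u (_ , ψ∈Γ))
      Γ (λ (ψ , ψ∈Γ) → reflect ψ (subst (_∈ Γ) (sym ([]-id ψ)) ψ∈Γ))))

-- Valuations in a completion.

module Completions {ℓ} (𝓛 : Language ℓ)
                   (𝐆 : Completion (Logic.Lindenbaum 𝓛)) where
  open Logic 𝓛
  open Derivations 𝓛
  open Soundness 𝓛
  open CutElimination 𝓛 using (cut-elimination)
  open Completion 𝐆 renaming (refl to ≤-refl; trans to ≤-trans)
  open Structure 𝐆
  private module L = HeytingAlgebra Lindenbaum

  ≤-≈-trans : ∀ {x y z} → x ≤ y → y ≈ z → x ≤ z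
  ≤-≈-trans p q = ≤-trans p (reflexive q)

  ≈-≤-trans : ∀ {x y z} → x ≈ y → y ≤ z → x ≤ z
  ≈-≤-trans p q = ≤-trans (reflexive p) q

  -- The embedding is specified by equations, so the order is recovered from `a ∼ a ∧ᶠ b`, here and
  -- in `ι-cancel`.
  ι-mono : ∀ {a b} → a ≲ b → ι a ≤ ι b
  ι-mono {a} {b} a≲b = ≈-≤-trans
    (Eq.trans (ι-cong (L.antisym (L.∧-greatest L.refl a≲b) (L.x∧y≤x a b))) (ι-∧ a b))
    (x∧y≤y _ _)

  ι-cancel : ∀ {a b} → ι a ≤ ι b → a ≲ b
  ι-cancel {a} {b} ιa≤ιb = L.trans (L.reflexive (L.Eq.sym (ι-injective e))) (L.x∧y≤y a b)
    where
    e : ι (a ∧ᶠ b) ≈ ι a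
    e = Eq.trans (ι-∧ a b) (antisym (x∧y≤x _ _) (∧-greatest ≤-refl ιa≤ιb))

  ⟦⟧-rename : ∀ φ {X Y 𝒱 𝒲} → (∀ Z → Z ∈ FV φ → ∀ t → 𝒱 (rename Y X Z) t ≈ 𝒲 Z t) →
              ∀ {ρ} → ⟦ φ ⟨ Y / X ⟩ˢ ⟧ 𝒱 ρ ≈ ⟦ φ ⟧ 𝒲 ρ
  ⟦⟧-rename (rel p ts)  e = Eq.refl
  ⟦⟧-rename (Z · t)     e = e Z (here refl) _
  ⟦⟧-rename bot         e = Eq.refl
  ⟦⟧-rename (bin c φ ψ) e = conn-cong c
    (⟦⟧-rename φ λ Z p → e Z (∈-++⁺ˡ p)) (⟦⟧-rename ψ λ Z p → e Z (∈-++⁺ʳ (FV φ) p))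
  ⟦⟧-rename (quant Q φ) e = quant-cong Q λ t → ⟦⟧-rename φ e

  ⟦⟧-local : ∀ φ {𝒱 𝒲} → (∀ Z → Z ∈ FV φ → ∀ t → 𝒱 Z t ≈ 𝒲 Z t) →
             ∀ {ρ} → ⟦ φ ⟧ 𝒱 ρ ≈ ⟦ φ ⟧ 𝒲 ρ
  ⟦⟧-local (rel p ts)  e = Eq.refl
  ⟦⟧-local (Z · t)     e = e Z (here refl) _
  ⟦⟧-local bot         e = Eq.refl
  ⟦⟧-local (bin c φ ψ) e = conn-cong c
    (⟦⟧-local φ λ Z p → e Z (∈-++⁺ˡ p)) (⟦⟧-local ψ λ Z p → e Z (∈-++⁺ʳ (FV φ) p))
  ⟦⟧-local (quant Q φ) e = quant-cong Q λ t → ⟦⟧-local φ e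

  rename-eq : ∀ Y X → rename Y X X ≡ Y
  rename-eq Y X with X ≟ X
  ... | yes _  = refl
  ... | no X≢X = ⊥-elim (X≢X refl)

  update-eq : ∀ {𝒱 F} X → (𝒱 [ F / X ]ⱽ) X ≡ F
  update-eq X with X ≟ X
  ... | yes _  = refl
  ... | no X≢X = ⊥-elim (X≢X refl)

  update-≢ : ∀ {𝒱 F} X Y → Y ≢ X → (𝒱 [ F / X ]ⱽ) Y ≡ 𝒱 Y
  update-≢ X Y Y≢X with Y ≟ X
  ... | yes Y≡X = ⊥-elim (Y≢X Y≡X)
  ... | no _    = refl

  ⟦⟧-update : ∀ φ {X F 𝒱 ρ} → X ∉ FV φ → ⟦ φ ⟧ (𝒱 [ F / X ]ⱽ) ρ ≈ ⟦ φ ⟧ 𝒱 ρ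
  ⟦⟧-update φ {X} {F} {𝒱} X∉φ = ⟦⟧-local φ λ Z Z∈φ t →
    Eq.reflexive (cong (λ f → f t)
      (update-≢ {𝒱} {F} X Z λ { refl → X∉φ Z∈φ }))

  -- As `φ` has no free set variable besides `X`, the two valuations need to match just in the
  -- predicate that replaces `X`.
  ⟦⟧-⟨/⟩ˢ : ∀ φ {X Y 𝒱 𝒲 F ρ} → FV φ ⊆ X ∷ [] → (∀ t → 𝒱 Y t ≈ F t) →
            ⟦ φ ⟨ Y / X ⟩ˢ ⟧ 𝒱 ρ ≈ ⟦ φ ⟧ (𝒲 [ F / X ]ⱽ) ρ
  ⟦⟧-⟨/⟩ˢ φ {X} {Y} {𝒱} {𝒲} {F} φ⊆X e = ⟦⟧-rename φ λ Z Z∈φ → e′ Z (φ⊆X Z∈φ)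
    where
    e′ : ∀ Z → Z ∈ X ∷ [] → ∀ t → 𝒱 (rename Y X Z) t ≈ (𝒲 [ F / X ]ⱽ) Z t
    e′ Z (here refl) t = Eq.trans
      (Eq.reflexive (cong (λ V → 𝒱 V t) (rename-eq Y X)))
      (Eq.trans (e t) (Eq.reflexive (cong (λ f → f t) (sym (update-eq X)))))

  interpretation : Valuation → Interpretation heytingAlgebra
  interpretation 𝒱 = record
    { ⟦_⟧   = λ φ → ⟦ φ ⟧ 𝒱
    ; ⟦bot⟧ = Eq.refl
    ; ⟦∧⟧   = Eq.refl
    ; ⟦∨⟧   = Eq.refl
    ; ⟦→⟧   = Eq.refl
    ; ⟦∀⟧   = ⋀-inf _
    ; ⟦∃⟧   = ⋁-sup _
    ; ⟦[]⟧  = λ φ → ⟦⟧-[] φ 𝒱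
    }

  -- Soundness is applied at 𝓘 [ F / Y ]ⱽ for every F: as Y is fresh for Δ, the
  -- value of the antecedent does not depend on F.
  evalˢ≤∀² : ∀ {X φ Δ} (φ⊆X : FV φ ⊆ X ∷ []) →
             ∣∀² X , φ ∣₀ Δ → evalˢ 𝓘 Δ ≤ eval₀ 𝓘 (∀² X φ φ⊆X)
  evalˢ≤∀² {X} {φ} {Δ} φ⊆X (Y , Y∉Δ , d) = proj₂ (⋀-inf _) _ λ { x (F , x≈) →
    ≤-≈-trans (sound (𝓘 [ F / Y ]ⱽ) d λ {ψ} ψ∈Δ →
        ≤-≈-trans (proj₁ (⋀-inf _) _ (ψ , ψ∈Δ , Eq.refl))
                  (Eq.sym (⟦⟧-update ψ (Y∉Δ ψ ψ∈Δ))))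
      (Eq.trans (⟦⟧-⟨/⟩ˢ φ φ⊆X λ t → Eq.reflexive (cong (λ f → f t) (update-eq Y)))
        (Eq.sym x≈)) }
    where
    sound : ∀ 𝒱 {m Γ Π x} → m ⊢ Γ ⇒ Π →
            let open Interpretation (interpretation 𝒱) in x ≤⟦ Γ ⟧ var → x ≤ ⟦ Π ⟧ᴹ var
    sound 𝒱 = Interpretation.sound (interpretation 𝒱)

  -- The instance at a fresh variable already yields the quantified formula. Together with `≲-∃`
  -- this exhibits the quantifiers as meets and joins existing in the Lindenbaum algebra.
  ≲-∀ : ∀ φ → IsInf _≲_ (λ ψ → ∃[ t ] ψ ≡ φ ⟨ t ⟩) (∀ᶠ φ)
  ≲-∀ φ = (λ { _ (t , refl) → ∀L t id }) , λ ψ d → ∀R-instances λ t → d _ (t , refl)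

  ≲-∃ : ∀ φ → IsSup _≲_ (λ ψ → ∃[ t ] ψ ≡ φ ⟨ t ⟩) (∃ᶠ φ)
  ≲-∃ φ = (λ { _ (t , refl) → ∃R t id }) , λ ψ d → ∃L-instances λ t → d _ (t , refl)

  -- Values as classes in a regular completion.

  module _ (regular : IsRegular) where

    -- Connectives are preserved by `ι`; for quantifiers, regularity transfers the meets and joins
    -- of `≲-∀` and `≲-∃` to the completion, where they agree with those over the term domain.
    𝓘-class : ∀ φ {ρ} → ⟦ φ ⟧ 𝓘 ρ ≈ ι (φ [ ρ ])
    𝓘-class (rel p ts) = Eq.refl
    𝓘-class (X · t)    = Eq.refl
    𝓘-class bot        = Eq.sym ι-⊥
    𝓘-class (φ ∧ᶠ ψ)   = Eq.trans (conn-cong and (𝓘-class φ) (𝓘-class ψ)) (Eq.sym (ι-∧ _ _))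
    𝓘-class (φ ∨ᶠ ψ)   = Eq.trans (conn-cong or  (𝓘-class φ) (𝓘-class ψ)) (Eq.sym (ι-∨ _ _))
    𝓘-class (φ →ᶠ ψ)   = Eq.trans (conn-cong imp (𝓘-class φ) (𝓘-class ψ)) (Eq.sym (ι-⇨ _ _))
    𝓘-class (∀ᶠ φ) {ρ} with proj₂ (regular _ _) (≲-∀ (φ [ lift ρ ]))
    ... | lower , greatest = antisym
      (greatest _ λ { x (_ , (t , refl) , x≈) →
        ≤-≈-trans (proj₁ (⋀-inf _) _ (t , Eq.refl)) (Eq.trans (instance-class t) (Eq.sym x≈)) })
      (proj₂ (⋀-inf _) _ λ { x (t , x≈) →
        ≤-≈-trans (lower _ (_ , (t , refl) , Eq.refl))
          (Eq.trans (Eq.sym (instance-class t)) (Eq.sym x≈)) })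
      where
      instance-class : ∀ t → ⟦ φ ⟧ 𝓘 (t • ρ) ≈ ι (φ [ lift ρ ] ⟨ t ⟩)
      instance-class t =
        Eq.trans (𝓘-class φ) (Eq.reflexive (cong ι (sym (lift-⟨⟩ φ ρ t))))
    𝓘-class (∃ᶠ φ) {ρ} with proj₁ (regular _ _) (≲-∃ (φ [ lift ρ ]))
    ... | upper , least = antisym
      (proj₂ (⋁-sup _) _ λ { x (t , x≈) →
        ≈-≤-trans (Eq.trans x≈ (instance-class t)) (upper _ (_ , (t , refl) , Eq.refl)) })
      (least _ λ { x (_ , (t , refl) , x≈) →
        ≈-≤-trans (Eq.trans x≈ (Eq.sym (instance-class t)))
          (proj₁ (⋁-sup _) _ (t , Eq.refl)) })
      where
      instance-class : ∀ t → ⟦ φ ⟧ 𝓘 (t • ρ) ≈ ι (φ [ lift ρ ] ⟨ t ⟩)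
      instance-class t =
        Eq.trans (𝓘-class φ) (Eq.reflexive (cong ι (sym (lift-⟨⟩ φ ρ t))))

    eval-class : ∀ φ → eval 𝓘 φ ≈ ι φ
    eval-class φ = Eq.trans (𝓘-class φ) (Eq.reflexive (cong ι ([]-id φ)))

    ⋀ᶠ-lower : ∀ {ψ Δ} → ψ ∈ Δ → ⋀ᶠ Δ ≲ ψ
    ⋀ᶠ-lower (here refl) = ∧L₁ id
    ⋀ᶠ-lower (there ψ∈Δ) = ∧L₂ (⋀ᶠ-lower ψ∈Δ)

    ⋀ᶠ-greatest : ∀ {x} Δ → (∀ ψ → ψ ∈ Δ → x ≤ ι ψ) → x ≤ ι (⋀ᶠ Δ)
    ⋀ᶠ-greatest []      h = ≤-≈-trans (maximum _) (Eq.sym ι-⊤)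
    ⋀ᶠ-greatest (ψ ∷ Δ) h = ≤-≈-trans
      (∧-greatest (h ψ (here refl)) (⋀ᶠ-greatest Δ λ χ p → h χ (there p)))
      (Eq.sym (ι-∧ _ _))

    evalˢ-class : ∀ Δ → evalˢ 𝓘 Δ ≈ ι (⋀ᶠ Δ)
    evalˢ-class Δ = antisym
      (⋀ᶠ-greatest Δ λ ψ ψ∈Δ →
        ≤-≈-trans (proj₁ (⋀-inf _) _ (ψ , ψ∈Δ , Eq.refl)) (eval-class ψ))
      (proj₂ (⋀-inf _) _ λ { x (ψ , ψ∈Δ , x≈) →
        ≤-≈-trans (ι-mono (⋀ᶠ-lower ψ∈Δ)) (Eq.sym (Eq.trans x≈ (eval-class ψ))) })

    -- The three conditions.

    module _ X φ (φ⊆X : FV φ ⊆ X ∷ []) where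

      ∀φ : Carrier
      ∀φ = eval₀ 𝓘 (∀² X φ φ⊆X)

      ≤∀²⇒∈∣∣₀ : ∀ {a} → ι a ≤ ∀φ → ∣∀² X , φ ∣₀ (a ∷ [])
      ≤∀²⇒∈∣∣₀ {a} ιa≤∀φ with fresh (FV a)
      -- The order of the Lindenbaum algebra is derivability with cut, while membership asks for a
      -- cut-free derivation.
      ... | Y , Y∉a = Y , (λ { _ (here refl) → Y∉a }) , cut-elimination (ι-cancel (begin
        ι a                          ≤⟨ ιa≤∀φ ⟩
        ∀φ                           ≤⟨ proj₁ (⋀-inf _) _ (𝓘 Y , Eq.refl) ⟩
        eval (𝓘 [ 𝓘 Y / X ]ⱽ) φ     ≈⟨ ⟦⟧-⟨/⟩ˢ φ φ⊆X (λ _ → Eq.refl) ⟨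
        eval 𝓘 (φ ⟨ Y / X ⟩ˢ)       ≈⟨ eval-class (φ ⟨ Y / X ⟩ˢ) ⟩
        ι (φ ⟨ Y / X ⟩ˢ)             ∎))
        where open ≤-Reasoning poset

      ι⋀ᶠ≤∀² : ∀ {Δ} → ∣∀² X , φ ∣₀ Δ → ι (⋀ᶠ Δ) ≤ ∀φ
      ι⋀ᶠ≤∀² {Δ} Δ∈ = ≈-≤-trans (Eq.sym (evalˢ-class Δ)) (evalˢ≤∀² φ⊆X Δ∈)

      ⋁-least-∣∣₀ : ⋁ (image (λ Δ → ι (⋀ᶠ Δ)) ∣∀² X , φ ∣₀) ≤ ∀φ
      ⋁-least-∣∣₀ = proj₂ (⋁-sup _) _ λ { x (Δ , Δ∈ , x≈) → ≈-≤-trans x≈ (ι⋀ᶠ≤∀² Δ∈) }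

      -- Each `a` below `∀φ` contributes the singleton context `a ∷ []` to the second join.
      1⇒2 : Condition₁ X φ φ⊆X → Condition₂ X φ φ⊆X
      1⇒2 c = antisym
        (≈-≤-trans c (proj₂ (⋁-sup _) _ λ { x (a , ιa≤∀φ , x≈) → ≈-≤-trans x≈
          -- The conjunction of a singleton is `a ∧ᶠ ⊤ᶠ`, equal to `a` only up to equivalence.
          (≤-trans (⋀ᶠ-greatest (a ∷ []) λ { _ (here refl) → ≤-refl })
            (proj₁ (⋁-sup _) _ (a ∷ [] , ≤∀²⇒∈∣∣₀ ιa≤∀φ , Eq.refl))) }))
        ⋁-least-∣∣₀

      -- Each `⋀ᶠ Δ` is itself an element of the Lindenbaum algebra below `∀φ`.
      2⇒1 : Condition₂ X φ φ⊆X → Condition₁ X φ φ⊆X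
      2⇒1 c = antisym
        (≈-≤-trans c (proj₂ (⋁-sup _) _ λ { x (Δ , Δ∈ , x≈) →
          ≈-≤-trans x≈ (proj₁ (⋁-sup _) _ (⋀ᶠ Δ , ι⋀ᶠ≤∀² Δ∈ , Eq.refl)) }))
        (proj₂ (⋁-sup _) _ λ { x (a , ιa≤∀φ , x≈) → ≈-≤-trans x≈ ιa≤∀φ })

      2⇒3 : Condition₂ X φ φ⊆X → Condition₃ X φ φ⊆X
      2⇒3 c y h = ≈-≤-trans c (proj₂ (⋁-sup _) _ λ { x (Δ , Δ∈ , x≈) →
        ≈-≤-trans (Eq.trans x≈ (Eq.sym (evalˢ-class Δ))) (h Δ Δ∈) })

      3⇒2 : Condition₃ X φ φ⊆X → Condition₂ X φ φ⊆X
      3⇒2 c = antisym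
        -- The bound `y` is taken to be the join of the classes.
        (c _ λ Δ Δ∈ → ≈-≤-trans (evalˢ-class Δ) (proj₁ (⋁-sup _) _ (Δ , Δ∈ , Eq.refl)))
        ⋁-least-∣∣₀

theorem4p2 : ∀ {ℓ} (𝓛 : Language ℓ) → let open Logic 𝓛 in
    (𝐆 : Completion Lindenbaum) → Completion.IsRegular 𝐆 →
    let open Structure 𝐆 in
    (∀ X φ (φ⊆X : FV φ ⊆ X ∷ []) → IsSentence (∀² X φ φ⊆X) →
    (Condition₁ X φ φ⊆X ⇔ Condition₂ X φ φ⊆X) ×
    (Condition₂ X φ φ⊆X ⇔ Condition₃ X φ φ⊆X)) ×
    (Completion.IsMacNeille 𝐆 →
    ∀ X φ (φ⊆X : FV φ ⊆ X ∷ []) → IsSentence (∀² X φ φ⊆X) →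
    Condition₁ X φ φ⊆X × Condition₂ X φ φ⊆X × Condition₃ X φ φ⊆X)
theorem4p2 𝓛 𝐆 regular =
  (λ X φ φ⊆X _ → mk⇔ (1⇒2 regular X φ φ⊆X) (2⇒1 regular X φ φ⊆X)
               , mk⇔ (2⇒3 regular X φ φ⊆X) (3⇒2 regular X φ φ⊆X)) ,
  (λ macNeille X φ φ⊆X _ →
    -- Join density at the value of the sentence is literally condition 1.
    let c₁ = proj₁ (macNeille _)
        c₂ = 1⇒2 regular X φ φ⊆X c₁
    in c₁ , c₂ , 2⇒3 regular X φ φ⊆X c₂)
  where open Completions 𝓛 𝐆
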